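{- Let $\mathcal{J}(x,y)=\alpha x^2+\beta xy+\gamma y^2$ be an integral binary quadratic form with $\gcd(\alpha,\beta,\gamma)=1$ and $\beta^2-4\alpha\gamma\neq 0$. Let $F\in V_{\mathcal{J}}(\mathbb{Z})$ be irreducible with $Q_F$ maximal, and let $h,f,g$ be integral binary quadratic forms with $F=h(f,g)$ and $\mathcal{J}_{(f,g)}$ proportional to $\mathcal{J}$. Then $\Delta(h)$ is a fundamental discriminant, the pair $(f,g)$ is primitive, and $\Delta(\mathcal{J}_{(f,g)})=\pm 4$. In particular, $\Delta(\mathcal{J})\in\{1,4,-4\}$.
   Context: Twisted action: for $T=\begin{pmatrix}t_1&t_2\\t_3&t_4\end{pmatrix}\in\operatorname{GL}_2(\mathbb{R})$, $F_T(x,y)=\det(T)^{ -2}F(t_1x+t_2y,t_3x+t_4y)$ for binary quartic forms. $M_{\mathcal{J}}=\begin{pmatrix}\beta&2\gamma\\-2\alpha&-\beta\end{pmatrix}$ and $V_{\mathcal{J}}(\mathbb{Z})$ is the set of integral binary quartic forms $F$ with $F_{M_{\mathcal{J}}}=F$. For a binary quadratic form $\varphi=\varphi_2x^2+\varphi_1xy+\varphi_0y^2$, $\Delta(\varphi)=\varphi_1^2-4\varphi_2\varphi_0$. The Jacobian determinant of $(f,g)$ is $\mathcal{J}_{(f,g)}(x,y)=(f_2g_1-f_1g_2)x^2+2(f_2g_0-f_0g_2)xy+(f_1g_0-f_0g_1)y^2$; an integral pair $(f,g)$ is primitive if $\Delta(\mathcal{J}_{(f,g)})\neq0$ and the gcd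 of the $x^2$-coefficient, half the $xy$-coefficient and the $y^2$-coefficient of $\mathcal{J}_{(f,g)}$ is $1$. $h(f,g)$ means $h(f(x,y),g(x,y))$. For an irreducible integral binary quartic form $F=a_4x^4+a_3x^3y+a_2x^2y^2+a_1xy^3+a_0y^4$ and a root $\theta$ of $F(x,1)$, $Q_F=\mathbb{Z}\oplus\mathbb{Z}a_4\theta\oplus\mathbb{Z}(a_4\theta^2+a_3\theta)\oplus\mathbb{Z}(a_4\theta^3+a_3\theta^2+a_2\theta)$, an order in $\mathbb{Q}(\theta)$; it is maximal if it equals the ring of integers of $\mathbb{Q}(\theta)$. -}

module Defs where

open import Data.Nat as ℕ using (ℕ; zero; suc)
open import Data.Nat.Divisibility as ℕD using ()
open import Data.Integer as ℤ using (ℤ; +_; ∣_∣)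
open import Data.Integer.GCD using (gcd)
open import Data.Rational as ℚ using (ℚ; 0ℚ; 1ℚ)
open import Data.List using (List; []; _∷_; map; length)
open import Data.Product using (Σ; ∃; ∃-syntax; _×_; _,_)
open import Data.Sum using (_⊎_)
open import Relation.Nullary using (¬_; yes; no)
open import Relation.Binary.PropositionalEquality using (_≡_; _≢_)

-- Generic arithmetic of homogeneous binary forms, stored as coefficient
-- lists [c_d, c_{d-1}, ..., c_0] of x^d, x^{d-1}y, ..., y^d.
-- Products of forms are convolutions; sums are only used for forms of
-- the same degree (lists of equal length).

module FormOps (A : Set) (0# : A) (_⊕_ _⊗_ : A → A → A) where
  add : List A → List A → List A
  add []       q        = q
  add p        []       = p
  add (a ∷ p) (b ∷ q)   = (a ⊕ b) ∷ add p q

  scale : A → List A → List A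
  scale c = map (c ⊗_)

  mul : List A → List A → List A
  mul []      q = []
  mul (a ∷ p) [] = []
  mul (a ∷ p) q = add (scale a q) (0# ∷ mul p q)

module Zf = FormOps ℤ (+ 0) ℤ._+_ ℤ._*_
module Qf = FormOps ℚ 0ℚ ℚ._+_ ℚ._*_

toℚ : ℤ → ℚ
toℚ i = i ℚ./ 1

-- φ2 x^2 + φ1 xy + φ0 y^2
record BQF : Set where
  constructor bqf
  field
    c2 c1 c0 : ℤ

-- a4 x^4 + a3 x^3 y + a2 x^2 y^2 + a1 x y^3 + a0 y^4
record Quartic : Set where
  constructor quartic
  field
    a4 a3 a2 a1 a0 : ℤ

coeffsQ : BQF → List ℤ
coeffsQ (bqf a b c) = a ∷ b ∷ c ∷ []

coeffs4 : Quartic → List ℤ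
coeffs4 (quartic a b c d e) = a ∷ b ∷ c ∷ d ∷ e ∷ []

disc : BQF → ℤ
disc (bqf a b c) = b ℤ.* b ℤ.- (+ 4) ℤ.* a ℤ.* c

compose : BQF → BQF → BQF → List ℤ
compose (bqf h2 h1 h0) f g =
  Zf.add (Zf.scale h2 (Zf.mul (coeffsQ f) (coeffsQ f)))
    (Zf.add (Zf.scale h1 (Zf.mul (coeffsQ f) (coeffsQ g)))
            (Zf.scale h0 (Zf.mul (coeffsQ g) (coeffsQ g))))

jacobian : BQF → BQF → BQF
jacobian (bqf f2 f1 f0) (bqf g2 g1 g0) =
  bqf (f2 ℤ.* g1 ℤ.- f1 ℤ.* g2)
      ((+ 2) ℤ.* (f2 ℤ.* g0 ℤ.- f0 ℤ.* g2))
      (f1 ℤ.* g0 ℤ.- f0 ℤ.* g1)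

Primitive : BQF → BQF → Set
Primitive f@(bqf f2 f1 f0) g@(bqf g2 g1 g0) =
  disc (jacobian f g) ≢ + 0 ×
  gcd (gcd (f2 ℤ.* g1 ℤ.- f1 ℤ.* g2) (f2 ℤ.* g0 ℤ.- f0 ℤ.* g2))
      (f1 ℤ.* g0 ℤ.- f0 ℤ.* g1) ≡ + 1

Proportional : BQF → BQF → Set
Proportional (bqf a b c) (bqf a' b' c') =
  ∃[ λ' ] (λ' ≢ 0ℚ × toℚ a ≡ λ' ℚ.* toℚ a' × toℚ b ≡ λ' ℚ.* toℚ b'
                    × toℚ c ≡ λ' ℚ.* toℚ c')

-- total inverse on ℚ (only ever applied to nonzero arguments below)
inv : ℚ → ℚ
inv q with q ℚ.≟ 0ℚ
... | yes _  = 0ℚ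
... | no q≢0 = ℚ.1/_ q {{ℚ.≢-nonZero q≢0}}

substLin : Quartic → ℤ → ℤ → ℤ → ℤ → List ℤ
substLin (quartic a4 a3 a2 a1 a0) t1 t2 t3 t4 =
  Zf.add (Zf.scale a4 (L1 ^ 4))
  (Zf.add (Zf.scale a3 (Zf.mul (L1 ^ 3) L2))
  (Zf.add (Zf.scale a2 (Zf.mul (L1 ^ 2) (L2 ^ 2)))
  (Zf.add (Zf.scale a1 (Zf.mul L1 (L2 ^ 3)))
          (Zf.scale a0 (L2 ^ 4)))))
  where
  L1 = t1 ∷ t2 ∷ []
  L2 = t3 ∷ t4 ∷ []
  _^_ : List ℤ → ℕ → List ℤ
  p ^ zero  = + 1 ∷ []
  p ^ suc n = Zf.mul p (p ^ n)

twist : ℤ → ℤ → ℤ → ℤ → Quartic → List ℚ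
twist t1 t2 t3 t4 F =
  map (λ c → inv (d ℚ.* d) ℚ.* toℚ c) (substLin F t1 t2 t3 t4)
  where d = toℚ (t1 ℤ.* t4 ℤ.- t2 ℤ.* t3)

InVJ : BQF → Quartic → Set
InVJ (bqf α β γ) F =
  twist β ((+ 2) ℤ.* γ) (ℤ.- ((+ 2) ℤ.* α)) (ℤ.- β) F ≡ map toℚ (coeffs4 F)

Irreducible : Quartic → Set
Irreducible F =
  coeffs4 F ≢ map (λ _ → + 0) (coeffs4 F) ×
  ((d : ℕ) → 1 ℕ.≤ d → d ℕ.≤ 3 →
    ¬ (∃[ G ] ∃[ H ] (length G ≡ suc d × length H ≡ suc (4 ℕ.∸ d) ×
                      Qf.mul G H ≡ map toℚ (coeffs4 F))))

-- The field K = ℚ(θ) = ℚ[x]/(F(x,1)), elements r0 + r1 θ + r2 θ^2 + r3 θ^3.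
-- θ^4 = -(a3 θ^3 + a2 θ^2 + a1 θ + a0)/a4.

record K : Set where
  constructor k
  field
    r0 r1 r2 r3 : ℚ

module Field (F : Quartic) where
  open Quartic F
  b : ℤ → ℚ
  b a = toℚ a ℚ.* inv (toℚ a4)

  addK : K → K → K
  addK (k x0 x1 x2 x3) (k y0 y1 y2 y3) =
    k (x0 ℚ.+ y0) (x1 ℚ.+ y1) (x2 ℚ.+ y2) (x3 ℚ.+ y3)

  scaleK : ℚ → K → K
  scaleK c (k x0 x1 x2 x3) = k (c ℚ.* x0) (c ℚ.* x1) (c ℚ.* x2) (c ℚ.* x3)

  mulθ : K → K
  mulθ (k x0 x1 x2 x3) =
    k (ℚ.- (x3 ℚ.* b a0))
      (x0 ℚ.- x3 ℚ.* b a1)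
      (x1 ℚ.- x3 ℚ.* b a2)
      (x2 ℚ.- x3 ℚ.* b a3)

  mulK : K → K → K
  mulK z (k w0 w1 w2 w3) =
    addK (scaleK w0 z) (addK (scaleK w1 (mulθ z))
      (addK (scaleK w2 (mulθ (mulθ z))) (scaleK w3 (mulθ (mulθ (mulθ z))))))

  oneK zeroK : K
  oneK  = k 1ℚ 0ℚ 0ℚ 0ℚ
  zeroK = k 0ℚ 0ℚ 0ℚ 0ℚ

  -- value at z of the monic polynomial X^n + c_{n-1} X^{n-1} + ... + c_0,
  -- where cs = [c_{n-1}, ..., c_0] (Horner)
  evalMonic : List ℤ → K → K
  evalMonic cs z = go cs oneK
    where
    go : List ℤ → K → K
    go []       acc = acc
    go (c ∷ cs) acc = go cs (addK (mulK acc z) (scaleK (toℚ c) oneK))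

  IsIntegral : K → Set
  IsIntegral z = ∃[ cs ] evalMonic cs z ≡ zeroK

  -- z ∈ Q_F = ℤ ⊕ ℤ a4θ ⊕ ℤ(a4θ^2 + a3θ) ⊕ ℤ(a4θ^3 + a3θ^2 + a2θ)
  InQF : K → Set
  InQF z = ∃[ c0 ] ∃[ c1 ] ∃[ c2 ] ∃[ c3 ]
    (z ≡ k (toℚ c0)
           (toℚ (c1 ℤ.* a4 ℤ.+ c2 ℤ.* a3 ℤ.+ c3 ℤ.* a2))
           (toℚ (c2 ℤ.* a4 ℤ.+ c3 ℤ.* a3))
           (toℚ (c3 ℤ.* a4)))

-- Q_F is maximal: it contains every algebraic integer of ℚ(θ)
-- (Q_F ⊆ O_K always holds, so this says Q_F = O_K).
QFMaximal : Quartic → Set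
QFMaximal F = (z : K) → IsIntegral z → InQF z
  where open Field F

SquarefreeZ : ℤ → Set
SquarefreeZ m = (n : ℕ) → (n ℕ.* n) ℕD.∣ ∣ m ∣ → n ≡ 1

FundamentalDisc : ℤ → Set
FundamentalDisc D =
  (D ℤ.% (+ 4) ≡ 1 × SquarefreeZ D) ⊎
  (∃[ m ] (D ≡ (+ 4) ℤ.* m × (m ℤ.% (+ 4) ≡ 2 ⊎ m ℤ.% (+ 4) ≡ 3) × SquarefreeZ m))

{-# OPTIONS --safe #-}

-- Write 𝒥_(f,g) = (A, 2B, C) and R = B² − AC, so that Δ(𝒥_(f,g)) = 4R.
-- The element ω = h₂ f(θ)/g(θ) satisfies ω² + h₁ω + h₂h₀ = 0, hence is integral,
-- and its coordinates in the basis of Q_F, apart from that at 1, are −C/R, B/R, −A/R.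
-- Maximality makes R divide A, B and C, so R² divides R and R = ±1.
-- If Δ(h) = n²D′ with D′ a discriminant, then (ω + m)/n is integral for a
-- suitable integer m, and the same argument gives nR ∣ A, B, C, so n²R² ∣ R and
-- n = ±1: this says that Δ(h) is fundamental.
module Submission where

open import Defs
open import Data.Empty using (⊥; ⊥-elim)
open import Data.Integer as ℤ using (ℤ; +_; -_; -[1+_])
import Data.Integer.Coprimality as ℤC
import Data.Integer.Divisibility as ℤDᵤ
open import Data.Integer.Divisibility.Signed
open import Data.Integer.DivMod using (n%d<d; a≡a%n+[a/n]*n)
open import Data.Integer.GCD using (gcd; gcd[i,j]∣i; gcd[i,j]∣j; gcd-greatest)
import Data.Integer.Properties as ℤP
import Data.Integer.Solver as ℤS
open import Data.List using (List; []; _∷_; map)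
open import Data.Nat as ℕ using (ℕ; zero; suc; s≤s; z≤n)
import Data.Nat.Coprimality as ℕC
import Data.Nat.Divisibility as ℕD
import Data.Nat.Properties as ℕP
open import Data.Product using (∃-syntax; ∃₂; _×_; _,_; proj₁; proj₂)
open import Data.Rational as ℚ using (ℚ; 0ℚ; 1ℚ; mkℚ)
import Data.Rational.Properties as ℚP
import Data.Rational.Solver as ℚS
import Data.Rational.Unnormalised as ℚᵘ
import Data.Rational.Unnormalised.Properties as ℚᵘP
open import Data.Sum using (_⊎_; inj₁; inj₂; [_,_]′)
open import Relation.Binary.PropositionalEquality
open import Relation.Nullary using (yes; no; contradiction)

-- The embedding of ℤ into ℚ, and cancellation in ℚ.

toℚᵘ-toℚ : ∀ i → ℚ.toℚᵘ (toℚ i) ℚᵘ.≃ ℚᵘ.mkℚᵘ i 0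
toℚᵘ-toℚ i = ℚP.toℚᵘ-fromℚᵘ (ℚᵘ.mkℚᵘ i 0)

toℚ-injective : ∀ {i j} → toℚ i ≡ toℚ j → i ≡ j
toℚ-injective {i} {j} eq
  with ℚᵘ.*≡* p ← ℚᵘP.≃-trans (ℚᵘP.≃-sym (toℚᵘ-toℚ i)) (ℚᵘP.≃-trans (ℚP.toℚᵘ-cong eq) (toℚᵘ-toℚ j))
  = ℤP.*-cancelʳ-≡ i j (+ 1) p

toℚ-+ : ∀ i j → toℚ (i ℤ.+ j) ≡ toℚ i ℚ.+ toℚ j
toℚ-+ i j = ℚP.toℚᵘ-injective (begin
  ℚ.toℚᵘ (toℚ (i ℤ.+ j))                     ≈⟨ toℚᵘ-toℚ (i ℤ.+ j) ⟩
  ℚᵘ.mkℚᵘ (i ℤ.+ j) 0                        ≈⟨ ℚᵘ.*≡* (solve 2 (λ x y →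
    (x :+ y) :* con (+ 1) := (x :* con (+ 1) :+ y :* con (+ 1)) :* con (+ 1)) refl i j) ⟩
  ℚᵘ.mkℚᵘ i 0 ℚᵘ.+ ℚᵘ.mkℚᵘ j 0               ≈⟨ ℚᵘP.+-cong (toℚᵘ-toℚ i) (toℚᵘ-toℚ j) ⟨
  ℚ.toℚᵘ (toℚ i) ℚᵘ.+ ℚ.toℚᵘ (toℚ j)         ≈⟨ ℚP.toℚᵘ-homo-+ (toℚ i) (toℚ j) ⟨
  ℚ.toℚᵘ (toℚ i ℚ.+ toℚ j)                   ∎)
  where
  open ℚᵘP.≃-Reasoning
  open ℤS.+-*-Solver

toℚ-* : ∀ i j → toℚ (i ℤ.* j) ≡ toℚ i ℚ.* toℚ j
toℚ-* i j = ℚP.toℚᵘ-injective (begin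
  ℚ.toℚᵘ (toℚ (i ℤ.* j))                     ≈⟨ toℚᵘ-toℚ (i ℤ.* j) ⟩
  ℚᵘ.mkℚᵘ i 0 ℚᵘ.* ℚᵘ.mkℚᵘ j 0               ≈⟨ ℚᵘP.*-cong (toℚᵘ-toℚ i) (toℚᵘ-toℚ j) ⟨
  ℚ.toℚᵘ (toℚ i) ℚᵘ.* ℚ.toℚᵘ (toℚ j)         ≈⟨ ℚP.toℚᵘ-homo-* (toℚ i) (toℚ j) ⟨
  ℚ.toℚᵘ (toℚ i ℚ.* toℚ j)                   ∎)
  where open ℚᵘP.≃-Reasoning

toℚ-neg : ∀ i → toℚ (- i) ≡ ℚ.- toℚ i
toℚ-neg i = ℚP.toℚᵘ-injective (begin
  ℚ.toℚᵘ (toℚ (- i))      ≈⟨ toℚᵘ-toℚ (- i) ⟩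
  ℚᵘ.- ℚᵘ.mkℚᵘ i 0        ≈⟨ ℚᵘP.-‿cong (toℚᵘ-toℚ i) ⟨
  ℚᵘ.- ℚ.toℚᵘ (toℚ i)     ≈⟨ ℚP.toℚᵘ-homo‿- (toℚ i) ⟨
  ℚ.toℚᵘ (ℚ.- toℚ i)      ∎)
  where open ℚᵘP.≃-Reasoning

inv-inverseˡ : ∀ {q} → q ≢ 0ℚ → inv q ℚ.* q ≡ 1ℚ
inv-inverseˡ {q} q≢0 with q ℚ.≟ 0ℚ
... | yes q≡0 = contradiction q≡0 q≢0
... | no  q≢0 = ℚP.*-inverseˡ q {{ℚ.≢-nonZero q≢0}}

*-cancelʳ : ∀ {p q r} → r ≢ 0ℚ → p ℚ.* r ≡ q ℚ.* r → p ≡ q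
*-cancelʳ {p} {q} {r} r≢0 eq = begin
  p                        ≡⟨ split p ⟩
  p ℚ.* r ℚ.* inv r        ≡⟨ cong (ℚ._* inv r) eq ⟩
  q ℚ.* r ℚ.* inv r        ≡⟨ split q ⟨
  q                        ∎
  where
  open ≡-Reasoning
  split : ∀ x → x ≡ x ℚ.* r ℚ.* inv r
  split x = begin
    x                      ≡⟨ ℚP.*-identityʳ x ⟨
    x ℚ.* 1ℚ               ≡⟨ cong (x ℚ.*_) (inv-inverseˡ r≢0) ⟨
    x ℚ.* (inv r ℚ.* r)    ≡⟨ cong (x ℚ.*_) (ℚP.*-comm (inv r) r) ⟩
    x ℚ.* (r ℚ.* inv r)    ≡⟨ ℚP.*-assoc x r (inv r) ⟨
    x ℚ.* r ℚ.* inv r      ∎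

-- Ring-independent formulas for Q_F and for ω.

≡₄ : ∀ {A : Set} {x0 x1 x2 x3 y0 y1 y2 y3 : A} → x0 ≡ y0 → x1 ≡ y1 → x2 ≡ y2 → x3 ≡ y3 →
     (x0 , x1 , x2 , x3) ≡ (y0 , y1 , y2 , y3)
≡₄ refl refl refl refl = refl

-- Every formula below is written once over these operations and then read
-- in ℤ, in ℚ, in the polynomial syntaxes of the two ring solvers, and in the
-- graph of toℚ (which transports it from ℤ to ℚ).
record Ops (A : Set) : Set where
  infixl 6 _+_ _-_
  infixl 7 _*_
  infix  8 neg_
  field
    0# 1# : A
    _+_ _*_ : A → A → A
    neg_ : A → A
  _-_ : A → A → A
  x - y = x + neg y

module Formulas {A : Set} (O : Ops A) where
  open Ops O
  open FormOps A 0# _+_ _*_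

  -- Lists start at the leading coefficient, so for a quartic `F i` below is the coefficient a₄₋ᵢ.
  nth : List A → ℕ → A
  nth []       _       = 0#
  nth (x ∷ _)  zero    = x
  nth (_ ∷ xs) (suc i) = nth xs i

  K₄ : Set
  K₄ = A × A × A × A

  -- Coordinates with respect to 1, a₄θ, a₄θ²+a₃θ, a₄θ³+a₃θ²+a₂θ.
  fromBasis : (F : ℕ → A) → K₄ → K₄
  fromBasis F (w0 , w1 , w2 , w3) =
    w0 , w1 * F 0 + w2 * F 1 + w3 * F 2 , w2 * F 0 + w3 * F 1 , w3 * F 0

  -- Coordinates of w² + u w + v, from the multiplication table of Q_F.
  quad : (F : ℕ → A) → A → A → K₄ → K₄
  quad F u v (w0 , w1 , w2 , w3) =
      w0 * w0 + u * w0 + v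
        - F 4 * (F 0 * w1 * w3 + F 0 * w1 * w3 + F 0 * w2 * w2
                 + F 1 * w2 * w3 + F 1 * w2 * w3 + F 2 * w3 * w3)
    , (w0 + w0 + u) * w1
        - (F 1 * w1 * w1 + F 2 * w1 * w2 + F 2 * w1 * w2 + F 3 * w1 * w3
           + F 3 * w1 * w3 + F 3 * w2 * w2 + F 4 * w2 * w3 + F 4 * w2 * w3)
    , (w0 + w0 + u) * w2 + F 0 * w1 * w1
        - (F 2 * w2 * w2 + F 3 * w2 * w3 + F 3 * w2 * w3 + F 4 * w3 * w3)
    , (w0 + w0 + u) * w3 + F 0 * w1 * w2 + F 0 * w1 * w2 + F 1 * w2 * w2
        - F 3 * w3 * w3

  scaleK : A → K₄ → K₄
  scaleK c (x0 , x1 , x2 , x3) = c * x0 , c * x1 , c * x2 , c * x3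

  -- Arithmetic in the basis 1, θ, θ², θ³ with θ⁴ = -(b₃θ³ + b₂θ² + b₁θ + b₀). The clauses repeat
  -- those of `Field`, on tuples instead of `K`.
  module Power (b3 b2 b1 b0 : A) where
    addK : K₄ → K₄ → K₄
    addK (x0 , x1 , x2 , x3) (y0 , y1 , y2 , y3) = x0 + y0 , x1 + y1 , x2 + y2 , x3 + y3


    mulθ : K₄ → K₄
    mulθ (x0 , x1 , x2 , x3) = neg (x3 * b0) , x0 - x3 * b1 , x1 - x3 * b2 , x2 - x3 * b3

    mulK : K₄ → K₄ → K₄
    mulK z (w0 , w1 , w2 , w3) =
      addK (scaleK w0 z) (addK (scaleK w1 (mulθ z))
        (addK (scaleK w2 (mulθ (mulθ z))) (scaleK w3 (mulθ (mulθ (mulθ z))))))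

    oneK : K₄
    oneK = 1# , 0# , 0# , 0#

    evalQuad : A → A → K₄ → K₄
    evalQuad u v z = addK (mulK (addK (mulK oneK z) (scaleK u oneK)) z) (scaleK v oneK)

  module Composite (h2 h1 h0 f2 f1 f0 g2 g1 g0 : A) where
    F : ℕ → A
    F = nth (add (scale h2 (mul (f2 ∷ f1 ∷ f0 ∷ []) (f2 ∷ f1 ∷ f0 ∷ [])))
          (add (scale h1 (mul (f2 ∷ f1 ∷ f0 ∷ []) (g2 ∷ g1 ∷ g0 ∷ [])))
               (scale h0 (mul (g2 ∷ g1 ∷ g0 ∷ []) (g2 ∷ g1 ∷ g0 ∷ [])))))

    -- The A, B, C and R of the introduction.
    a b c R : A
    a = f2 * g1 - f1 * g2
    b = f2 * g0 - f0 * g2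
    c = f1 * g0 - f0 * g1
    R = b * b - a * c

    -- R (h₂ f(θ)/g(θ) + m)
    ω : A → K₄
    ω m = h2 * f0 * (f2 * b - f1 * a) + (h1 * f0 + h0 * g0) * (g2 * b - g1 * a) + m * R
        , neg c , b , neg a

    -- Substituting X - m in X² + h₁X + h₂h₀ and scaling by R shows that R(ω + m) is a root of X² +
    -- `trace m` X + `norm m`; so `trace` is the linear coefficient, the negative of the usual
    -- trace.
    trace norm : A → A
    trace m = (h1 - m - m) * R
    norm m = (h2 * h0 - h1 * m + m * m) * (R * R)

ℤ-ops : Ops ℤ
ℤ-ops = record { 0# = + 0 ; 1# = + 1 ; _+_ = ℤ._+_ ; _*_ = ℤ._*_ ; neg_ = -_ }

ℚ-ops : Ops ℚ
ℚ-ops = record { 0# = 0ℚ ; 1# = 1ℚ ; _+_ = ℚ._+_ ; _*_ = ℚ._*_ ; neg_ = ℚ.-_ }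

ℤ-poly-ops : ∀ {n} → Ops (ℤS.+-*-Solver.Polynomial n)
ℤ-poly-ops = record { 0# = con (+ 0) ; 1# = con (+ 1) ; _+_ = _:+_ ; _*_ = _:*_ ; neg_ = :-_ }
  where open ℤS.+-*-Solver

ℚ-poly-ops : ∀ {n} → Ops (ℚS.+-*-Solver.Polynomial n)
ℚ-poly-ops = record { 0# = con 0ℚ ; 1# = con 1ℚ ; _+_ = _:+_ ; _*_ = _:*_ ; neg_ = :-_ }
  where open ℚS.+-*-Solver

Graph : Set
Graph = ∃₂ λ i q → toℚ i ≡ q

graph-ops : Ops Graph
graph-ops = record
  { 0#   = + 0 , 0ℚ , refl
  ; 1#   = + 1 , 1ℚ , refl
  ; _+_  = λ { (i , _ , p) (j , _ , q) → i ℤ.+ j , _ , trans (toℚ-+ i j) (cong₂ ℚ._+_ p q) }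
  ; _*_  = λ { (i , _ , p) (j , _ , q) → i ℤ.* j , _ , trans (toℚ-* i j) (cong₂ ℚ._*_ p q) }
  ; neg_ = λ { (i , _ , p) → - i , _ , trans (toℚ-neg i) (cong ℚ.-_ p) }
  }

module Fℤ = Formulas ℤ-ops
module Fℚ = Formulas ℚ-ops
module Fℤ′ {n} = Formulas (ℤ-poly-ops {n})
module Fℚ′ {n} = Formulas (ℚ-poly-ops {n})
module G = Formulas graph-ops

-- Polynomial identities for ω and for the multiplication table.

module _ where
  open ℤS.+-*-Solver

  private
    coordinate : (∀ {n} → Fℤ′.K₄ {n} → Polynomial n) →
      ∀ {n} (h2 h1 h0 f2 f1 f0 g2 g1 g0 m : Polynomial n) → Polynomial n × Polynomial n
    coordinate π h2 h1 h0 f2 f1 f0 g2 g1 g0 m = π (Fℤ′.quad F (trace m) (norm m) (ω m)) := con (+ 0)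
      where open Fℤ′.Composite h2 h1 h0 f2 f1 f0 g2 g1 g0

  -- The equation of ω as four formal identities in ten variables, one for each coordinate. The
  -- coordinates of `ω m` are polynomials, so the quotient f(θ)/g(θ) never has to be formed.
  quad-ω : ∀ h2 h1 h0 f2 f1 f0 g2 g1 g0 m → let open Fℤ.Composite h2 h1 h0 f2 f1 f0 g2 g1 g0 in
    Fℤ.quad F (trace m) (norm m) (ω m) ≡ (+ 0 , + 0 , + 0 , + 0)
  quad-ω h2 h1 h0 f2 f1 f0 g2 g1 g0 m = ≡₄
    (solve 10 (coordinate proj₁) refl h2 h1 h0 f2 f1 f0 g2 g1 g0 m)
    (solve 10 (coordinate (λ x → proj₁ (proj₂ x))) refl h2 h1 h0 f2 f1 f0 g2 g1 g0 m)
    (solve 10 (coordinate (λ x → proj₁ (proj₂ (proj₂ x)))) refl h2 h1 h0 f2 f1 f0 g2 g1 g0 m)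
    (solve 10 (coordinate (λ x → proj₂ (proj₂ (proj₂ x)))) refl h2 h1 h0 f2 f1 f0 g2 g1 g0 m)

-- `quad` uses the coefficients of F, `evalQuad` their quotients by a₄. Writing F as a times a monic
-- quartic makes comparing the two a polynomial identity without division.
monicMultiple : ∀ {A} (O : Ops A) (a b3 b2 b1 b0 : A) → List A
monicMultiple O a b3 b2 b1 b0 = a ∷ a * b3 ∷ a * b2 ∷ a * b1 ∷ a * b0 ∷ []
  where open Ops O

module _ where
  open ℚS.+-*-Solver

  private
    coordinate : (∀ {m} → Fℚ′.K₄ {m} → Polynomial m) →
      ∀ {m} (a b3 b2 b1 b0 u v w0 w1 w2 w3 : Polynomial m) → Polynomial m × Polynomial m
    coordinate π a b3 b2 b1 b0 u v w0 w1 w2 w3 =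
      π (Fℚ′.Power.evalQuad b3 b2 b1 b0 u v (Fℚ′.fromBasis F w)) := π (Fℚ′.fromBasis F (Fℚ′.quad F u v w))
      where
      F = Fℚ′.nth (monicMultiple ℚ-poly-ops a b3 b2 b1 b0)
      w = w0 , w1 , w2 , w3

  -- This is what justifies the table in `quad`: it agrees with multiplication in ℚ(θ) computed in
  -- powers of θ.
  evalQuad-fromBasis : ∀ a b3 b2 b1 b0 u v w →
    let F = Fℚ.nth (monicMultiple ℚ-ops a b3 b2 b1 b0) in
    Fℚ.Power.evalQuad b3 b2 b1 b0 u v (Fℚ.fromBasis F w) ≡ Fℚ.fromBasis F (Fℚ.quad F u v w)
  evalQuad-fromBasis a b3 b2 b1 b0 u v (w0 , w1 , w2 , w3) = ≡₄
    (solve 11 (coordinate proj₁) refl a b3 b2 b1 b0 u v w0 w1 w2 w3)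
    (solve 11 (coordinate (λ x → proj₁ (proj₂ x))) refl a b3 b2 b1 b0 u v w0 w1 w2 w3)
    (solve 11 (coordinate (λ x → proj₁ (proj₂ (proj₂ x)))) refl a b3 b2 b1 b0 u v w0 w1 w2 w3)
    (solve 11 (coordinate (λ x → proj₂ (proj₂ (proj₂ x)))) refl a b3 b2 b1 b0 u v w0 w1 w2 w3)

module _ where
  open ℚS.+-*-Solver

  private
    coordinate : (∀ {m} → Fℚ′.K₄ {m} → Polynomial m) →
      ∀ {m} (r u v a4 a3 a2 a1 a0 w0 w1 w2 w3 : Polynomial m) → Polynomial m × Polynomial m
    coordinate π r u v a4 a3 a2 a1 a0 w0 w1 w2 w3 =
      π (Fℚ′.quad F (r :* u) (r :* r :* v) (Fℚ′.scaleK r w)) := π (Fℚ′.scaleK (r :* r) (Fℚ′.quad F u v w))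
      where
      F = Fℚ′.nth (a4 ∷ a3 ∷ a2 ∷ a1 ∷ a0 ∷ [])
      w = w0 , w1 , w2 , w3

  -- With weight 1 for u and w and weight 2 for v, every coordinate of `quad` has weight 2. Taking r
  -- = 1/d passes from an equation of N to one of N/d.
  quad-homogeneous : ∀ r u v a4 a3 a2 a1 a0 w →
    let F = Fℚ.nth (a4 ∷ a3 ∷ a2 ∷ a1 ∷ a0 ∷ []) in
    Fℚ.quad F (r ℚ.* u) (r ℚ.* r ℚ.* v) (Fℚ.scaleK r w) ≡ Fℚ.scaleK (r ℚ.* r) (Fℚ.quad F u v w)
  quad-homogeneous r u v a4 a3 a2 a1 a0 (w0 , w1 , w2 , w3) = ≡₄
    (solve 12 (coordinate proj₁) refl r u v a4 a3 a2 a1 a0 w0 w1 w2 w3)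
    (solve 12 (coordinate (λ x → proj₁ (proj₂ x))) refl r u v a4 a3 a2 a1 a0 w0 w1 w2 w3)
    (solve 12 (coordinate (λ x → proj₁ (proj₂ (proj₂ x)))) refl r u v a4 a3 a2 a1 a0 w0 w1 w2 w3)
    (solve 12 (coordinate (λ x → proj₂ (proj₂ (proj₂ x)))) refl r u v a4 a3 a2 a1 a0 w0 w1 w2 w3)

-- Transport from ℤ to ℚ, and the change of basis.

toK : Fℚ.K₄ → K
toK (w0 , w1 , w2 , w3) = k w0 w1 w2 w3

toℚ₄ : Fℤ.K₄ → Fℚ.K₄
toℚ₄ (w0 , w1 , w2 , w3) = toℚ w0 , toℚ w1 , toℚ w2 , toℚ w3

graph : ℤ → Graph
graph i = i , toℚ i , refl

0₄ : Fℚ.K₄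
0₄ = 0ℚ , 0ℚ , 0ℚ , 0ℚ

quad-toℚ : ∀ a4 a3 a2 a1 a0 u v w →
  Fℚ.quad (Fℚ.nth (map toℚ (a4 ∷ a3 ∷ a2 ∷ a1 ∷ a0 ∷ []))) (toℚ u) (toℚ v) (toℚ₄ w) ≡
  toℚ₄ (Fℤ.quad (Fℤ.nth (a4 ∷ a3 ∷ a2 ∷ a1 ∷ a0 ∷ [])) u v w)
quad-toℚ a4 a3 a2 a1 a0 u v (w0 , w1 , w2 , w3) = sym (prf image)
  where
  -- One evaluation in `Graph` yields, for each coordinate, the integer value, the rational value
  -- and the equation between them.
  image : G.K₄
  image = G.quad (G.nth (graph a4 ∷ graph a3 ∷ graph a2 ∷ graph a1 ∷ graph a0 ∷ []))
            (graph u) (graph v) (graph w0 , graph w1 , graph w2 , graph w3)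
  prf : ∀ (x : G.K₄) → let (x0 , x1 , x2 , x3) = x in
    toℚ₄ (proj₁ x0 , proj₁ x1 , proj₁ x2 , proj₁ x3) ≡
    (proj₁ (proj₂ x0) , proj₁ (proj₂ x1) , proj₁ (proj₂ x2) , proj₁ (proj₂ x3))
  prf ((_ , _ , p0) , (_ , _ , p1) , (_ , _ , p2) , (_ , _ , p3)) = ≡₄ p0 p1 p2 p3

fromBasis-0 : ∀ (F : ℕ → ℚ) r → Fℚ.fromBasis F (Fℚ.scaleK r 0₄) ≡ 0₄
fromBasis-0 F r = ≡₄
  (ℚP.*-zeroʳ r)
  (solve 4 (λ r x y z → r :* con 0ℚ :* x :+ r :* con 0ℚ :* y :+ r :* con 0ℚ :* z := con 0ℚ) refl r (F 0) (F 1) (F 2))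
  (solve 3 (λ r x y → r :* con 0ℚ :* x :+ r :* con 0ℚ :* y := con 0ℚ) refl r (F 0) (F 1))
  (solve 2 (λ r x → r :* con 0ℚ :* x := con 0ℚ) refl r (F 0))
  where open ℚS.+-*-Solver

+-cancelʳ : ∀ {p q r} → p ℚ.+ r ≡ q ℚ.+ r → p ≡ q
+-cancelʳ {p} {q} {r} = ∙-cancelʳ r p q
  where open import Algebra.Properties.Group ℚP.+-0-group using (∙-cancelʳ)

-- The change of basis is triangular with diagonal 1, a₄, a₄, a₄, so the coordinates are recovered
-- from the last one backwards.
fromBasis-injective : ∀ (F : ℕ → ℚ) → F 0 ≢ 0ℚ → ∀ {w w′} → Fℚ.fromBasis F w ≡ Fℚ.fromBasis F w′ → w ≡ w′
fromBasis-injective F F0≢0 {w0 , w1 , w2 , w3} {w0′ , w1′ , w2′ , w3′} eq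
  with refl ← cong proj₁ eq
  with refl ← *-cancelʳ {w3} {w3′} F0≢0 (cong (λ x → proj₂ (proj₂ (proj₂ x))) eq)
  with refl ← *-cancelʳ {w2} {w2′} F0≢0
                (+-cancelʳ {_} {_} {w3 ℚ.* F 1} (cong (λ x → proj₁ (proj₂ (proj₂ x))) eq))
  with refl ← *-cancelʳ {w1} {w1′} F0≢0
                (+-cancelʳ {_} {_} {w2 ℚ.* F 1} (+-cancelʳ {_} {_} {w3 ℚ.* F 2} (cong (λ x → proj₁ (proj₂ x)) eq)))
  = refl

-- Divisibility from maximality.

-- If N ∈ Q_F and d is such that N/d is a root of X² + uX + v, then N/d is
-- integral, so maximality puts it in Q_F.
maximal⇒divides : ∀ F → Quartic.a4 F ≢ + 0 → QFMaximal F → ∀ d → d ≢ + 0 → ∀ u v N0 N1 N2 N3 →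
  Fℤ.quad (Fℤ.nth (coeffs4 F)) (d ℤ.* u) (d ℤ.* d ℤ.* v) (N0 , N1 , N2 , N3) ≡ (+ 0 , + 0 , + 0 , + 0) →
  d ∣ N1 × d ∣ N2 × d ∣ N3
maximal⇒divides F@(quartic a4 a3 a2 a1 a0) a4≢0 maximal d d≢0 u v N0 N1 N2 N3 quadN≡0 =
  conclusion (maximal z (u ∷ v ∷ [] , integral))
  where
  open ≡-Reasoning
  open Field F using (b; evalMonic; zeroK; InQF)

  ρ : ℚ
  ρ = inv (toℚ d)

  ρd≡1 : ρ ℚ.* toℚ d ≡ 1ℚ
  ρd≡1 = inv-inverseˡ (λ eq → d≢0 (toℚ-injective eq))

  A≢0 : toℚ a4 ≢ 0ℚ
  A≢0 eq = a4≢0 (toℚ-injective eq)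

  Fs : List ℚ
  Fs = map toℚ (coeffs4 F)

  -- `w` holds the coordinates of N/d in the basis of Q_F; `z` below is the same element in powers
  -- of θ.
  N w : Fℚ.K₄
  N = toℚ₄ (N0 , N1 , N2 , N3)
  w = Fℚ.scaleK ρ N

  z : K
  z = toK (Fℚ.fromBasis (Fℚ.nth Fs) w)

  a≡a4b : ∀ a → toℚ a ≡ toℚ a4 ℚ.* b a
  a≡a4b a = begin
    toℚ a                              ≡⟨ ℚP.*-identityʳ (toℚ a) ⟨
    toℚ a ℚ.* 1ℚ                       ≡⟨ cong (toℚ a ℚ.*_) (inv-inverseˡ A≢0) ⟨
    toℚ a ℚ.* (inv (toℚ a4) ℚ.* toℚ a4) ≡⟨ ℚP.*-assoc (toℚ a) _ _ ⟨
    b a ℚ.* toℚ a4                     ≡⟨ ℚP.*-comm (b a) (toℚ a4) ⟩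
    toℚ a4 ℚ.* b a                     ∎

  Fs≡ : Fs ≡ monicMultiple ℚ-ops (toℚ a4) (b a3) (b a2) (b a1) (b a0)
  Fs≡ = cong (toℚ a4 ∷_) (cong₂ _∷_ (a≡a4b a3) (cong₂ _∷_ (a≡a4b a2)
          (cong₂ _∷_ (a≡a4b a1) (cong (_∷ []) (a≡a4b a0)))))

  ρ[dx]≡x : ∀ x → ρ ℚ.* toℚ (d ℤ.* x) ≡ toℚ x
  ρ[dx]≡x x = begin
    ρ ℚ.* toℚ (d ℤ.* x)       ≡⟨ cong (ρ ℚ.*_) (toℚ-* d x) ⟩
    ρ ℚ.* (toℚ d ℚ.* toℚ x)   ≡⟨ ℚP.*-assoc ρ _ _ ⟨
    ρ ℚ.* toℚ d ℚ.* toℚ x     ≡⟨ cong (ℚ._* toℚ x) ρd≡1 ⟩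
    1ℚ ℚ.* toℚ x              ≡⟨ ℚP.*-identityˡ (toℚ x) ⟩
    toℚ x                     ∎

  ρρ[ddx]≡x : ∀ x → ρ ℚ.* ρ ℚ.* toℚ (d ℤ.* d ℤ.* x) ≡ toℚ x
  ρρ[ddx]≡x x = begin
    ρ ℚ.* ρ ℚ.* toℚ (d ℤ.* d ℤ.* x)       ≡⟨ cong (λ y → ρ ℚ.* ρ ℚ.* toℚ y) (ℤP.*-assoc d d x) ⟩
    ρ ℚ.* ρ ℚ.* toℚ (d ℤ.* (d ℤ.* x))     ≡⟨ ℚP.*-assoc ρ ρ _ ⟩
    ρ ℚ.* (ρ ℚ.* toℚ (d ℤ.* (d ℤ.* x)))   ≡⟨ cong (ρ ℚ.*_) (ρ[dx]≡x (d ℤ.* x)) ⟩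
    ρ ℚ.* toℚ (d ℤ.* x)                   ≡⟨ ρ[dx]≡x x ⟩
    toℚ x                                 ∎

  quad-w≡0 : Fℚ.quad (Fℚ.nth Fs) (toℚ u) (toℚ v) w ≡ Fℚ.scaleK (ρ ℚ.* ρ) 0₄
  quad-w≡0 = begin
    Fℚ.quad (Fℚ.nth Fs) (toℚ u) (toℚ v) w
      ≡⟨ cong₂ (λ x y → Fℚ.quad (Fℚ.nth Fs) x y w) (sym (ρ[dx]≡x u)) (sym (ρρ[ddx]≡x v)) ⟩
    Fℚ.quad (Fℚ.nth Fs) (ρ ℚ.* toℚ (d ℤ.* u)) (ρ ℚ.* ρ ℚ.* toℚ (d ℤ.* d ℤ.* v)) w
      ≡⟨ quad-homogeneous ρ (toℚ (d ℤ.* u)) (toℚ (d ℤ.* d ℤ.* v)) (toℚ a4) (toℚ a3) (toℚ a2) (toℚ a1) (toℚ a0) N ⟩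
    Fℚ.scaleK (ρ ℚ.* ρ) (Fℚ.quad (Fℚ.nth Fs) (toℚ (d ℤ.* u)) (toℚ (d ℤ.* d ℤ.* v)) N)
      ≡⟨ cong (Fℚ.scaleK (ρ ℚ.* ρ)) (quad-toℚ a4 a3 a2 a1 a0 (d ℤ.* u) (d ℤ.* d ℤ.* v) (N0 , N1 , N2 , N3)) ⟩
    Fℚ.scaleK (ρ ℚ.* ρ) (toℚ₄ (Fℤ.quad (Fℤ.nth (coeffs4 F)) (d ℤ.* u) (d ℤ.* d ℤ.* v) (N0 , N1 , N2 , N3)))
      ≡⟨ cong (λ x → Fℚ.scaleK (ρ ℚ.* ρ) (toℚ₄ x)) quadN≡0 ⟩
    Fℚ.scaleK (ρ ℚ.* ρ) 0₄ ∎

  evalQuad≡0 : Fℚ.Power.evalQuad (b a3) (b a2) (b a1) (b a0) (toℚ u) (toℚ v) (Fℚ.fromBasis (Fℚ.nth Fs) w) ≡ 0₄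
  evalQuad≡0 = begin
    evalAt Fs                                                          ≡⟨ cong evalAt Fs≡ ⟩
    evalAt (monicMultiple ℚ-ops (toℚ a4) (b a3) (b a2) (b a1) (b a0))
      ≡⟨ evalQuad-fromBasis (toℚ a4) (b a3) (b a2) (b a1) (b a0) (toℚ u) (toℚ v) w ⟩
    quadAt (monicMultiple ℚ-ops (toℚ a4) (b a3) (b a2) (b a1) (b a0))  ≡⟨ cong quadAt Fs≡ ⟨
    quadAt Fs                                                          ≡⟨ cong (Fℚ.fromBasis (Fℚ.nth Fs)) quad-w≡0 ⟩
    Fℚ.fromBasis (Fℚ.nth Fs) (Fℚ.scaleK (ρ ℚ.* ρ) 0₄)                  ≡⟨ fromBasis-0 (Fℚ.nth Fs) (ρ ℚ.* ρ) ⟩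
    0₄                                                                 ∎
    where
    evalAt quadAt : List ℚ → Fℚ.K₄
    evalAt L = Fℚ.Power.evalQuad (b a3) (b a2) (b a1) (b a0) (toℚ u) (toℚ v) (Fℚ.fromBasis (Fℚ.nth L) w)
    quadAt L = Fℚ.fromBasis (Fℚ.nth L) (Fℚ.quad (Fℚ.nth L) (toℚ u) (toℚ v) w)

  -- On a two-element list `evalMonic` unfolds to `evalQuad`, so only the passage from tuples to `K`
  -- remains.
  integral : evalMonic (u ∷ v ∷ []) z ≡ zeroK
  integral = cong toK evalQuad≡0

  divides′ : ∀ {n c} → ρ ℚ.* toℚ n ≡ toℚ c → d ∣ n
  divides′ {n} {c} eq = divides c (toℚ-injective (begin
    toℚ n                        ≡⟨ ρ[dx]≡x n ⟨
    ρ ℚ.* toℚ (d ℤ.* n)          ≡⟨ cong (ρ ℚ.*_) (trans (cong toℚ (ℤP.*-comm d n)) (toℚ-* n d)) ⟩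
    ρ ℚ.* (toℚ n ℚ.* toℚ d)      ≡⟨ ℚP.*-assoc ρ _ _ ⟨
    ρ ℚ.* toℚ n ℚ.* toℚ d        ≡⟨ cong (ℚ._* toℚ d) eq ⟩
    toℚ c ℚ.* toℚ d              ≡⟨ toℚ-* c d ⟨
    toℚ (c ℤ.* d)                ∎))

  conclusion : InQF z → d ∣ N1 × d ∣ N2 × d ∣ N3
  conclusion (c0 , c1 , c2 , c3 , z≡) =
      divides′ {N1} {c1} (cong (λ x → proj₁ (proj₂ x)) w≡c)
    , divides′ {N2} {c2} (cong (λ x → proj₁ (proj₂ (proj₂ x))) w≡c)
    , divides′ {N3} {c3} (cong (λ x → proj₂ (proj₂ (proj₂ x))) w≡c)
    where
    fromK : K → Fℚ.K₄
    fromK (k x0 x1 x2 x3) = x0 , x1 , x2 , x3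

    two : ∀ x y p q → toℚ (x ℤ.* y ℤ.+ p ℤ.* q) ≡ toℚ x ℚ.* toℚ y ℚ.+ toℚ p ℚ.* toℚ q
    two x y p q = trans (toℚ-+ (x ℤ.* y) (p ℤ.* q)) (cong₂ ℚ._+_ (toℚ-* x y) (toℚ-* p q))

    -- Membership in Q_F gives integers c₀, ..., c₃ representing `z` in the same basis as `w`;
    -- uniqueness of coordinates identifies them.
    w≡c : w ≡ toℚ₄ (c0 , c1 , c2 , c3)
    w≡c = fromBasis-injective (Fℚ.nth Fs) A≢0 (trans (cong fromK z≡) (≡₄ refl
      (trans (toℚ-+ (c1 ℤ.* a4 ℤ.+ c2 ℤ.* a3) (c3 ℤ.* a2)) (cong₂ ℚ._+_ (two c1 a4 c2 a3) (toℚ-* c3 a2)))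
      (two c2 a4 c3 a3)
      (toℚ-* c3 a4)))

-- If a₄ = 0, then F is the linear form y, stored as `0ℚ ∷ 1ℚ ∷ []`, times a cubic.
irreducible⇒a4≢0 : ∀ F → Irreducible F → Quartic.a4 F ≢ + 0
irreducible⇒a4≢0 (quartic a4 a3 a2 a1 a0) (_ , noFactor) refl =
  noFactor 1 (s≤s z≤n) (s≤s z≤n)
    ( 0ℚ ∷ 1ℚ ∷ [] , map toℚ (a3 ∷ a2 ∷ a1 ∷ a0 ∷ []) , refl , refl
    , cong₂ _∷_ (solve 1 (λ x → con 0ℚ :* x :+ con 0ℚ := con 0ℚ) refl (toℚ a3))
      (cong₂ _∷_ (solve 2 (λ x y → con 0ℚ :* x :+ (con 1ℚ :* y :+ con 0ℚ) := y) refl (toℚ a2) (toℚ a3))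
      (cong₂ _∷_ (drop (toℚ a1) (toℚ a2))
      (cong₂ _∷_ (drop (toℚ a0) (toℚ a1))
      (cong (_∷ []) (ℚP.*-identityˡ (toℚ a0)))))))
  where
  open ℚS.+-*-Solver
  drop : ∀ x y → 0ℚ ℚ.* x ℚ.+ 1ℚ ℚ.* y ≡ y
  drop = solve 2 (λ x y → con 0ℚ :* x :+ con 1ℚ :* y := y) refl

-- Units and parity in ℤ.

∣1⇒∣i∣≡1 : ∀ {i} → i ∣ + 1 → ℤ.∣ i ∣ ≡ 1
∣1⇒∣i∣≡1 i∣1 = ℕD.∣1⇒≡1 (∣⇒∣ᵤ i∣1)

∣1⇒±1 : ∀ {i} → i ∣ + 1 → i ≡ + 1 ⊎ i ≡ - (+ 1)
∣1⇒±1 {i} i∣1 with ℤP.+∣i∣≡i⊎+∣i∣≡-i i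
... | inj₁ e = inj₁ (trans (sym e) (cong +_ (∣1⇒∣i∣≡1 i∣1)))
... | inj₂ e = inj₂ (trans (sym (ℤP.neg-involutive i)) (cong -_ (trans (sym e) (cong +_ (∣1⇒∣i∣≡1 i∣1)))))

2∤1 : ∀ x → + 1 ≢ + 2 ℤ.* x
2∤1 x eq with () ← ∣1⇒∣i∣≡1 (divides {+ 2} x (trans eq (ℤP.*-comm (+ 2) x)))

parity : ∀ x → (∃[ q ] x ≡ q ℤ.+ q) ⊎ (∃[ q ] x ≡ + 1 ℤ.+ (q ℤ.+ q))
parity x with x ℤ.% + 2 | n%d<d x (+ 2) | a≡a%n+[a/n]*n x (+ 2)
... | 0 | _ | eq = inj₁ (q , trans eq (solve 1 (λ q → con (+ 0) :+ q :* con (+ 2) := q :+ q) refl q))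
  where
  open ℤS.+-*-Solver
  q = x ℤ./ + 2
... | 1 | _ | eq = inj₂ (q , trans eq (solve 1 (λ q → con (+ 1) :+ q :* con (+ 2) := con (+ 1) :+ (q :+ q)) refl q))
  where
  open ℤS.+-*-Solver
  q = x ℤ./ + 2
... | suc (suc _) | s≤s (s≤s ()) | _

-- Unit bounds for R and for the index n.

module _ (F : Quartic) (irreducible : Irreducible F) (maximal : QFMaximal F)
         (h2 h1 h0 f2 f1 f0 g2 g1 g0 : ℤ)
         (F≡ : coeffs4 F ≡ compose (bqf h2 h1 h0) (bqf f2 f1 f0) (bqf g2 g1 g0))
  where
  open Fℤ.Composite h2 h1 h0 f2 f1 f0 g2 g1 g0 using (a; b; c; R; ω; trace; norm)
  open ℤS.+-*-Solver

  module _ (R≢0 : R ≢ + 0) where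

    -- (h₂ f(θ)/g(θ) + m)/n is a root of X² + uX + v.
    nR∣1 : ∀ n m u v → n ≢ + 0 → n ℤ.* u ≡ h1 ℤ.- m ℤ.- m →
           n ℤ.* n ℤ.* v ≡ h2 ℤ.* h0 ℤ.- h1 ℤ.* m ℤ.+ m ℤ.* m → n ℤ.* R ∣ + 1
    -- The numerator is R(ω + m) and the denominator d = nR, with quotient (ω + m)/n.
    nR∣1 n m u v n≢0 nu≡ nnv≡ = unit (maximal⇒divides F (irreducible⇒a4≢0 F irreducible) maximal d d≢0 u v
        (proj₁ (ω m)) (- c) b (- a) quad≡0)
      where
      open ≡-Reasoning
      d = n ℤ.* R

      d≢0 : d ≢ + 0
      d≢0 eq with ℤP.i*j≡0⇒i≡0∨j≡0 n eq
      ... | inj₁ n≡0 = n≢0 n≡0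
      ... | inj₂ R≡0 = R≢0 R≡0

      du≡ : d ℤ.* u ≡ trace m
      du≡ = begin
        n ℤ.* R ℤ.* u      ≡⟨ solve 3 (λ n R u → n :* R :* u := n :* u :* R) refl n R u ⟩
        n ℤ.* u ℤ.* R      ≡⟨ cong (ℤ._* R) nu≡ ⟩
        trace m            ∎

      ddv≡ : d ℤ.* d ℤ.* v ≡ norm m
      ddv≡ = begin
        n ℤ.* R ℤ.* (n ℤ.* R) ℤ.* v  ≡⟨ solve 3 (λ n R v → n :* R :* (n :* R) :* v := n :* n :* v :* (R :* R)) refl n R v ⟩
        n ℤ.* n ℤ.* v ℤ.* (R ℤ.* R)  ≡⟨ cong (ℤ._* (R ℤ.* R)) nnv≡ ⟩
        norm m                       ∎

      quad≡0 : Fℤ.quad (Fℤ.nth (coeffs4 F)) (d ℤ.* u) (d ℤ.* d ℤ.* v) (ω m) ≡ (+ 0 , + 0 , + 0 , + 0)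
      quad≡0 = begin
        Fℤ.quad (Fℤ.nth (coeffs4 F)) (d ℤ.* u) (d ℤ.* d ℤ.* v) (ω m)
          ≡⟨ cong₂ (λ x y → Fℤ.quad (Fℤ.nth (coeffs4 F)) x y (ω m)) du≡ ddv≡ ⟩
        Fℤ.quad (Fℤ.nth (coeffs4 F)) (trace m) (norm m) (ω m)
          ≡⟨ cong (λ L → Fℤ.quad (Fℤ.nth L) (trace m) (norm m) (ω m)) F≡ ⟩
        Fℤ.quad (Fℤ.nth (compose (bqf h2 h1 h0) (bqf f2 f1 f0) (bqf g2 g1 g0))) (trace m) (norm m) (ω m)
          ≡⟨ quad-ω h2 h1 h0 f2 f1 f0 g2 g1 g0 m ⟩
        (+ 0 , + 0 , + 0 , + 0) ∎

      -- Since R = b² - (-a)(-c), d² divides R; as d² = n · d · R, cancelling R leaves a multiple of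
      -- d equal to 1.
      unit : (d ∣ - c) × (d ∣ b) × (d ∣ - a) → d ∣ + 1
      unit (divides q1 -c≡ , divides q2 b≡ , divides q3 -a≡) =
        divides ((q2 ℤ.* q2 ℤ.- q3 ℤ.* q1) ℤ.* n)
          (ℤP.*-cancelʳ-≡ (+ 1) _ R {{ℤ.≢-nonZero R≢0}} (begin
            + 1 ℤ.* R
              ≡⟨ solve 3 (λ a b c → con (+ 1) :* (b :* b :- a :* c) := b :* b :- (:- a) :* (:- c)) refl a b c ⟩
            b ℤ.* b ℤ.- (- a) ℤ.* (- c)
              ≡⟨ cong₂ (λ x y → x ℤ.* x ℤ.- y) b≡ (cong₂ ℤ._*_ -a≡ -c≡) ⟩
            q2 ℤ.* d ℤ.* (q2 ℤ.* d) ℤ.- q3 ℤ.* d ℤ.* (q1 ℤ.* d)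
              ≡⟨ solve 5 (λ n R q1 q2 q3 → q2 :* (n :* R) :* (q2 :* (n :* R)) :- q3 :* (n :* R) :* (q1 :* (n :* R))
                   := (q2 :* q2 :- q3 :* q1) :* n :* (n :* R) :* R) refl n R q1 q2 q3 ⟩
            (q2 ℤ.* q2 ℤ.- q3 ℤ.* q1) ℤ.* n ℤ.* d ℤ.* R ∎))

    R∣1 : R ∣ + 1
    -- The choice n = 1, m = 0 is ω itself.
    R∣1 = subst (_∣ + 1) (ℤP.*-identityˡ R) (nR∣1 (+ 1) (+ 0) h1 (h2 ℤ.* h0) (λ ())
      (solve 1 (λ h1 → con (+ 1) :* h1 := h1 :- con (+ 0) :- con (+ 0)) refl h1)
      (solve 3 (λ h2 h1 h0 → con (+ 1) :* con (+ 1) :* (h2 :* h0) :=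
         h2 :* h0 :- h1 :* con (+ 0) :+ con (+ 0) :* con (+ 0)) refl h2 h1 h0))

    -- The order of discriminant s² − 4t contains the one of discriminant Δ(h)
    -- with index n.
    index∣1-nonzero : ∀ n s t → n ≢ + 0 →
      disc (bqf h2 h1 h0) ≡ n ℤ.* n ℤ.* (s ℤ.* s ℤ.- + 4 ℤ.* t) → n ∣ + 1
    index∣1-nonzero n s t n≢0 D≡ with parity (h1 ℤ.+ n ℤ.* s)
    -- As ω = (-h₁ ± n√(s² - 4t))/2, the choice 2m = h₁ + ns makes (ω + m)/n equal to (s ± √(s² -
    -- 4t))/2, a root of X² - sX + t.
    ... | inj₁ (m , h1+ns≡2m) = ∣-trans (∣m⇒∣m*n R ∣-refl) (nR∣1 n m (- s) t n≢0 nu≡ nnt≡)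
      where
      open ≡-Reasoning
      nu≡ : n ℤ.* (- s) ≡ h1 ℤ.- m ℤ.- m
      nu≡ = begin
        n ℤ.* (- s)                 ≡⟨ solve 3 (λ n s h1 → n :* (:- s) := h1 :- (h1 :+ n :* s)) refl n s h1 ⟩
        h1 ℤ.- (h1 ℤ.+ n ℤ.* s)     ≡⟨ cong (ℤ._-_ h1) h1+ns≡2m ⟩
        h1 ℤ.- (m ℤ.+ m)            ≡⟨ solve 2 (λ h1 m → h1 :- (m :+ m) := h1 :- m :- m) refl h1 m ⟩
        h1 ℤ.- m ℤ.- m              ∎
      x = h2 ℤ.* h0 ℤ.- h1 ℤ.* m ℤ.+ m ℤ.* m
      nnt≡ : n ℤ.* n ℤ.* t ≡ x
      -- Four times a constant term is the square of the linear coefficient minus the discriminant.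
      -- Both agree by `nu≡` and `D≡`.
      nnt≡ = ℤP.*-cancelˡ-≡ (+ 4) _ _ (begin
        + 4 ℤ.* (n ℤ.* n ℤ.* t)
          ≡⟨ solve 3 (λ n s t → con (+ 4) :* (n :* n :* t) := (n :* (:- s)) :* (n :* (:- s)) :- n :* n :* (s :* s :- con (+ 4) :* t)) refl n s t ⟩
        n ℤ.* (- s) ℤ.* (n ℤ.* (- s)) ℤ.- n ℤ.* n ℤ.* (s ℤ.* s ℤ.- + 4 ℤ.* t)
          ≡⟨ cong₂ (λ y z → y ℤ.* y ℤ.- z) nu≡ (sym D≡) ⟩
        (h1 ℤ.- m ℤ.- m) ℤ.* (h1 ℤ.- m ℤ.- m) ℤ.- disc (bqf h2 h1 h0)
          ≡⟨ solve 4 (λ h2 h1 h0 m → (h1 :- m :- m) :* (h1 :- m :- m) :- (h1 :* h1 :- con (+ 4) :* h2 :* h0)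
               := con (+ 4) :* (h2 :* h0 :- h1 :* m :+ m :* m)) refl h2 h1 h0 m ⟩
        + 4 ℤ.* x ∎)
    -- Modulo 2, `D≡` reads h₁² ≡ (ns)², so h₁ + ns cannot be odd; `w` is the witness making 1 even.
    ... | inj₂ (q , h1+ns≡1+2q) = contradiction (begin
        + 1
          ≡⟨ solve 1 (λ q → con (+ 1) := p′ q :* p′ q :- con (+ 2) :* (q :+ q :+ q :* (q :+ q))) refl q ⟩
        p ℤ.* p ℤ.- + 2 ℤ.* y
          ≡⟨ cong (λ x → x ℤ.* x ℤ.- + 2 ℤ.* y) (sym h1+ns≡1+2q) ⟩
        (h1 ℤ.+ n ℤ.* s) ℤ.* (h1 ℤ.+ n ℤ.* s) ℤ.- + 2 ℤ.* y
          ≡⟨ solve 7 (λ h2 h1 h0 n s t y → (h1 :+ n :* s) :* (h1 :+ n :* s) :- con (+ 2) :* y :=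
               (h1 :* h1 :- con (+ 4) :* h2 :* h0) :- n :* n :* (s :* s :- con (+ 4) :* t) :+ con (+ 2) :*
               (h2 :* h0 :+ h2 :* h0 :+ h1 :* n :* s :+ n :* n :* (s :* s :- t :- t) :- y)) refl h2 h1 h0 n s t y ⟩
        disc (bqf h2 h1 h0) ℤ.- n ℤ.* n ℤ.* (s ℤ.* s ℤ.- + 4 ℤ.* t) ℤ.+ + 2 ℤ.* w
          ≡⟨ cong (ℤ._+ + 2 ℤ.* w) (ℤP.i≡j⇒i-j≡0 D≡) ⟩
        + 0 ℤ.+ + 2 ℤ.* w
          ≡⟨ ℤP.+-identityˡ _ ⟩
        + 2 ℤ.* w ∎) (2∤1 w)
      where
      open ≡-Reasoning
      p′ : ∀ {n} → Polynomial n → Polynomial n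
      p′ q = con (+ 1) :+ (q :+ q)
      p = + 1 ℤ.+ (q ℤ.+ q)
      y = q ℤ.+ q ℤ.+ q ℤ.* (q ℤ.+ q)
      w = h2 ℤ.* h0 ℤ.+ h2 ℤ.* h0 ℤ.+ h1 ℤ.* n ℤ.* s ℤ.+ n ℤ.* n ℤ.* (s ℤ.* s ℤ.- t ℤ.- t) ℤ.- y

    index∣1 : ∀ n s t → disc (bqf h2 h1 h0) ≡ n ℤ.* n ℤ.* (s ℤ.* s ℤ.- + 4 ℤ.* t) → n ∣ + 1
    index∣1 n s t D≡ with n ℤ.≟ + 0
    -- If n = 0, then Δ(h) = 0 = 2²(0² - 4 · 0), so 2 would be an admissible index too and would
    -- divide 1.
    ... | yes refl with () ← ∣1⇒∣i∣≡1 (index∣1-nonzero (+ 2) (+ 0) (+ 0) (λ ()) D≡)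
    ... | no n≢0 = index∣1-nonzero n s t n≢0 D≡

-- Residues modulo 4 and fundamental discriminants.

residue₄ : ∀ m → (∃[ q ] m ≡ + 4 ℤ.* q) ⊎ (∃[ q ] m ≡ + 1 ℤ.+ + 4 ℤ.* q) ⊎ (m ℤ.% + 4 ≡ 2 ⊎ m ℤ.% + 4 ≡ 3)
residue₄ m with m ℤ.% + 4 | n%d<d m (+ 4) | a≡a%n+[a/n]*n m (+ 4)
... | 0 | _ | eq = inj₁ (m ℤ./ + 4 , trans eq (trans (ℤP.+-identityˡ _) (ℤP.*-comm (m ℤ./ + 4) (+ 4))))
... | 1 | _ | eq = inj₂ (inj₁ (m ℤ./ + 4 , trans eq (cong (ℤ._+_ (+ 1)) (ℤP.*-comm (m ℤ./ + 4) (+ 4)))))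
... | 2 | _ | _  = inj₂ (inj₂ (inj₁ refl))
... | 3 | _ | _  = inj₂ (inj₂ (inj₂ refl))
... | suc (suc (suc (suc _))) | s≤s (s≤s (s≤s (s≤s ()))) | _

-- A remainder 0, 2 or 3 would make 1 or 2 a multiple of 4; for 2, one factor 2 is cancelled first.
1+4x%4≡1 : ∀ {m} x → m ≡ + 1 ℤ.+ + 4 ℤ.* x → m ℤ.% + 4 ≡ 1
1+4x%4≡1 {m} x m≡ with m ℤ.% + 4 | n%d<d m (+ 4) | a≡a%n+[a/n]*n m (+ 4)
... | 1 | _ | _ = refl
... | suc (suc (suc (suc _))) | s≤s (s≤s (s≤s (s≤s ()))) | _
... | 0 | _ | eq = contradiction (begin
    + 1                                 ≡⟨ solve 1 (λ x → con (+ 1) := con (+ 1) :+ con (+ 4) :* x :- con (+ 4) :* x) refl x ⟩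
    + 1 ℤ.+ + 4 ℤ.* x ℤ.- + 4 ℤ.* x     ≡⟨ cong (ℤ._- + 4 ℤ.* x) (trans (sym m≡) eq) ⟩
    + 0 ℤ.+ q ℤ.* + 4 ℤ.- + 4 ℤ.* x     ≡⟨ solve 2 (λ q x → con (+ 0) :+ q :* con (+ 4) :- con (+ 4) :* x := con (+ 2) :* (con (+ 2) :* (q :- x))) refl q x ⟩
    + 2 ℤ.* (+ 2 ℤ.* (q ℤ.- x))         ∎) (2∤1 _)
  where
  open ≡-Reasoning
  open ℤS.+-*-Solver
  q = m ℤ./ + 4
... | 2 | _ | eq = contradiction (begin
    + 1                                 ≡⟨ solve 1 (λ x → con (+ 1) := con (+ 2) :+ con (+ 4) :* x :- (con (+ 1) :+ con (+ 4) :* x)) refl x ⟩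
    + 2 ℤ.+ + 4 ℤ.* x ℤ.- (+ 1 ℤ.+ + 4 ℤ.* x)  ≡⟨ cong (ℤ._-_ (+ 2 ℤ.+ + 4 ℤ.* x)) (trans (sym m≡) eq) ⟩
    + 2 ℤ.+ + 4 ℤ.* x ℤ.- (+ 2 ℤ.+ q ℤ.* + 4)  ≡⟨ solve 2 (λ q x → con (+ 2) :+ con (+ 4) :* x :- (con (+ 2) :+ q :* con (+ 4)) := con (+ 2) :* (con (+ 2) :* (x :- q))) refl q x ⟩
    + 2 ℤ.* (+ 2 ℤ.* (x ℤ.- q))         ∎) (2∤1 _)
  where
  open ≡-Reasoning
  open ℤS.+-*-Solver
  q = m ℤ./ + 4
... | 3 | _ | eq = contradiction (ℤP.*-cancelˡ-≡ (+ 2) _ _ (begin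
    + 2 ℤ.* + 1                         ≡⟨ solve 1 (λ x → con (+ 2) := con (+ 3) :+ con (+ 4) :* x :- (con (+ 1) :+ con (+ 4) :* x)) refl x ⟩
    + 3 ℤ.+ + 4 ℤ.* x ℤ.- (+ 1 ℤ.+ + 4 ℤ.* x)  ≡⟨ cong (ℤ._-_ (+ 3 ℤ.+ + 4 ℤ.* x)) (trans (sym m≡) eq) ⟩
    + 3 ℤ.+ + 4 ℤ.* x ℤ.- (+ 3 ℤ.+ q ℤ.* + 4)  ≡⟨ solve 2 (λ q x → con (+ 3) :+ con (+ 4) :* x :- (con (+ 3) :+ q :* con (+ 4)) := con (+ 2) :* (con (+ 2) :* (x :- q))) refl q x ⟩
    + 2 ℤ.* (+ 2 ℤ.* (x ℤ.- q))         ∎)) (2∤1 _)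
  where
  open ≡-Reasoning
  open ℤS.+-*-Solver
  q = m ℤ./ + 4

squareDivisor : ∀ m n → n ℕ.* n ℕD.∣ ℤ.∣ m ∣ → ∃[ e ] m ≡ + n ℤ.* + n ℤ.* e
squareDivisor m n n²∣m with divides e m≡ ← ∣ᵤ⇒∣ {+ (n ℕ.* n)} {m} n²∣m =
  e , trans m≡ (trans (ℤP.*-comm e _) (cong (ℤ._* e) (ℤP.pos-* n n)))

-- The numbers s² - 4t are exactly the discriminants, so the hypothesis says that Δ(h) is n² times a
-- discriminant only for n = ±1. The values s = 0 and s = 1 cover the two classes modulo 4.
fundamental : ∀ h → (∀ n s t → disc h ≡ n ℤ.* n ℤ.* (s ℤ.* s ℤ.- + 4 ℤ.* t) → n ∣ + 1) → FundamentalDisc (disc h)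
fundamental (bqf h2 h1 h0) index∣1 with parity h1
... | inj₁ (q , refl) = inj₂ (m , D≡4m , m%4 (residue₄ m) , squarefree)
  where
  open ≡-Reasoning
  open ℤS.+-*-Solver
  m = q ℤ.* q ℤ.- h2 ℤ.* h0
  D = disc (bqf h2 (q ℤ.+ q) h0)
  D≡4m : D ≡ + 4 ℤ.* m
  D≡4m = solve 3 (λ h2 q h0 → (q :+ q) :* (q :+ q) :- con (+ 4) :* h2 :* h0 := con (+ 4) :* (q :* q :- h2 :* h0)) refl h2 q h0
  -- If m were 0 or 1 modulo 4, then m = Δ(h)/4 would be a discriminant and 2 an admissible index.
  index-two : ∀ s t → m ≡ s ℤ.* s ℤ.- + 4 ℤ.* t → ⊥
  index-two s t m≡ with () ← ∣1⇒∣i∣≡1 (index∣1 (+ 2) s t (trans D≡4m (cong (ℤ._*_ (+ 4)) m≡)))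
  m%4 : _ → m ℤ.% + 4 ≡ 2 ⊎ m ℤ.% + 4 ≡ 3
  m%4 (inj₁ (x , m≡)) = ⊥-elim (index-two (+ 0) (- x) (trans m≡
    (solve 1 (λ x → con (+ 4) :* x := con (+ 0) :* con (+ 0) :- con (+ 4) :* (:- x)) refl x)))
  m%4 (inj₂ (inj₁ (x , m≡))) = ⊥-elim (index-two (+ 1) (- x) (trans m≡
    (solve 1 (λ x → con (+ 1) :+ con (+ 4) :* x := con (+ 1) :* con (+ 1) :- con (+ 4) :* (:- x)) refl x)))
  m%4 (inj₂ (inj₂ r)) = r
  squarefree : SquarefreeZ m
  -- If m = n²e, then Δ(h) = n² · 4e, and 4e is a discriminant.
  squarefree n n²∣m with e , m≡ ← squareDivisor m n n²∣m = ∣1⇒∣i∣≡1 (index∣1 (+ n) (+ 0) (- e) (begin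
    D                               ≡⟨ D≡4m ⟩
    + 4 ℤ.* m                       ≡⟨ cong (ℤ._*_ (+ 4)) m≡ ⟩
    + 4 ℤ.* (+ n ℤ.* + n ℤ.* e)     ≡⟨ solve 2 (λ n e → con (+ 4) :* (n :* n :* e) := n :* n :* (con (+ 0) :* con (+ 0) :- con (+ 4) :* (:- e))) refl (+ n) e ⟩
    + n ℤ.* + n ℤ.* (+ 0 ℤ.* + 0 ℤ.- + 4 ℤ.* - e) ∎))
... | inj₂ (q , refl) = inj₁ (1+4x%4≡1 x D≡1+4x , squarefree)
  where
  open ≡-Reasoning
  open ℤS.+-*-Solver
  x = q ℤ.+ q ℤ.* q ℤ.- h2 ℤ.* h0
  D = disc (bqf h2 (+ 1 ℤ.+ (q ℤ.+ q)) h0)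
  D≡1+4x : D ≡ + 1 ℤ.+ + 4 ℤ.* x
  D≡1+4x = solve 3 (λ h2 q h0 → (con (+ 1) :+ (q :+ q)) :* (con (+ 1) :+ (q :+ q)) :- con (+ 4) :* h2 :* h0
    := con (+ 1) :+ con (+ 4) :* (q :+ q :* q :- h2 :* h0)) refl h2 q h0
  squarefree : SquarefreeZ D
  squarefree n n²∣D with e , D≡ ← squareDivisor D n n²∣D | parity (+ n)
  ... | inj₁ (r , n≡) = contradiction (begin
    + 1                                 ≡⟨ solve 1 (λ x → con (+ 1) := con (+ 1) :+ con (+ 4) :* x :- con (+ 4) :* x) refl x ⟩
    + 1 ℤ.+ + 4 ℤ.* x ℤ.- + 4 ℤ.* x     ≡⟨ cong (ℤ._- + 4 ℤ.* x) (trans (sym D≡1+4x) D≡) ⟩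
    + n ℤ.* + n ℤ.* e ℤ.- + 4 ℤ.* x     ≡⟨ cong (λ y → y ℤ.* y ℤ.* e ℤ.- + 4 ℤ.* x) n≡ ⟩
    (r ℤ.+ r) ℤ.* (r ℤ.+ r) ℤ.* e ℤ.- + 4 ℤ.* x
      ≡⟨ solve 3 (λ r e x → (r :+ r) :* (r :+ r) :* e :- con (+ 4) :* x := con (+ 2) :* (con (+ 2) :* (r :* r :* e :- x))) refl r e x ⟩
    + 2 ℤ.* (+ 2 ℤ.* (r ℤ.* r ℤ.* e ℤ.- x)) ∎) (2∤1 _)
  -- For odd n, n² = 1 + 4(r + r²), so e ≡ n²e = Δ(h) ≡ 1 modulo 4, and e = 1 - 4t is a
  -- discriminant.
  ... | inj₂ (r , n≡) = ∣1⇒∣i∣≡1 (index∣1 (+ n) (+ 1) t (begin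
    D                     ≡⟨ D≡ ⟩
    + n ℤ.* + n ℤ.* e     ≡⟨ cong (ℤ._*_ (+ n ℤ.* + n)) e≡ ⟩
    + n ℤ.* + n ℤ.* (+ 1 ℤ.* + 1 ℤ.- + 4 ℤ.* t) ∎))
    where
    t = (r ℤ.+ r ℤ.* r) ℤ.* e ℤ.- x
    e≡ : e ≡ + 1 ℤ.* + 1 ℤ.- + 4 ℤ.* t
    e≡ = begin
      e ≡⟨ solve 2 (λ r e → e := p r :* p r :* e :- con (+ 4) :* ((r :+ r :* r) :* e)) refl r e ⟩
      p′ ℤ.* p′ ℤ.* e ℤ.- + 4 ℤ.* ((r ℤ.+ r ℤ.* r) ℤ.* e)
        ≡⟨ cong (λ y → y ℤ.* y ℤ.* e ℤ.- + 4 ℤ.* ((r ℤ.+ r ℤ.* r) ℤ.* e)) (sym n≡) ⟩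
      + n ℤ.* + n ℤ.* e ℤ.- + 4 ℤ.* ((r ℤ.+ r ℤ.* r) ℤ.* e)
        ≡⟨ cong (ℤ._- + 4 ℤ.* ((r ℤ.+ r ℤ.* r) ℤ.* e)) (trans (sym D≡) D≡1+4x) ⟩
      + 1 ℤ.+ + 4 ℤ.* x ℤ.- + 4 ℤ.* ((r ℤ.+ r ℤ.* r) ℤ.* e)
        ≡⟨ solve 3 (λ r e x → con (+ 1) :+ con (+ 4) :* x :- con (+ 4) :* ((r :+ r :* r) :* e) :=
             con (+ 1) :* con (+ 1) :- con (+ 4) :* ((r :+ r :* r) :* e :- x)) refl r e x ⟩
      + 1 ℤ.* + 1 ℤ.- + 4 ℤ.* t ∎
      where
      p : ∀ {n} → Polynomial n → Polynomial n
      p r = con (+ 1) :+ (r :+ r)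
      p′ = + 1 ℤ.+ (r ℤ.+ r)

-- Proportional forms and the possible values of Δ(𝒥).

toℚ-ratio : ∀ {x α p q-1} .{co : ℕC.Coprime ℤ.∣ p ∣ (suc q-1)} → toℚ x ≡ mkℚ p q-1 co ℚ.* toℚ α → x ℤ.* + suc q-1 ≡ p ℤ.* α
toℚ-ratio {x} {α} {p} {q-1} {co} eq with ℚᵘ.*≡* cross ← ℚᵘP.≃-trans (ℚᵘP.≃-sym (toℚᵘ-toℚ x))
    (ℚᵘP.≃-trans (ℚP.toℚᵘ-cong eq) (ℚᵘP.≃-trans (ℚP.toℚᵘ-homo-* (mkℚ p q-1 co) (toℚ α))
      (ℚᵘP.*-congˡ {ℚᵘ.mkℚᵘ p q-1} (toℚᵘ-toℚ α)))) = begin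
  x ℤ.* + suc q-1              ≡⟨ cong (λ n → x ℤ.* + n) (ℕP.*-identityʳ (suc q-1)) ⟨
  x ℤ.* + (suc q-1 ℕ.* 1)      ≡⟨ cross ⟩
  p ℤ.* α ℤ.* + 1              ≡⟨ ℤP.*-identityʳ (p ℤ.* α) ⟩
  p ℤ.* α                      ∎
  where open ≡-Reasoning

-- Write the ratio as p/q in lowest terms. Then q, being coprime to p, divides α, β and γ, hence
-- their gcd 1.
proportional⇒multiple : ∀ φ α β γ → gcd (gcd α β) γ ≡ + 1 → Proportional φ (bqf α β γ) →
  ∃[ p ] (p ≢ + 0 × φ ≡ bqf (p ℤ.* α) (p ℤ.* β) (p ℤ.* γ))
proportional⇒multiple (bqf x y z) α β γ gcd≡1 (mkℚ p q-1 co , λ≢0 , x≡ , y≡ , z≡) =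
  p , (λ p≡0 → λ≢0 (ℚP.↥p≡0⇒p≡0 _ p≡0)) , bqf-cong (unscale x α x≡) (unscale y β y≡) (unscale z γ z≡)
  where
  q = + suc q-1

  bqf-cong : ∀ {x y z x′ y′ z′} → x ≡ x′ → y ≡ y′ → z ≡ z′ → bqf x y z ≡ bqf x′ y′ z′
  bqf-cong refl refl refl = refl

  q∣ : ∀ u μ → toℚ u ≡ mkℚ p q-1 co ℚ.* toℚ μ → q ℤDᵤ.∣ μ
  q∣ u μ eq = ℤC.coprime-divisor q p μ (ℕC.sym (ℕC.recompute co))
    (∣⇒∣ᵤ (divides u (sym (toℚ-ratio {u} {μ} {co = co} eq))))

  q≡1 : suc q-1 ≡ 1
  q≡1 = ℕD.∣1⇒≡1 (subst (q ℤDᵤ.∣_) gcd≡1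
    (gcd-greatest {gcd α β} {γ} {q} (gcd-greatest {α} {β} {q} (q∣ x α x≡) (q∣ y β y≡)) (q∣ z γ z≡)))

  unscale : ∀ u μ → toℚ u ≡ mkℚ p q-1 co ℚ.* toℚ μ → u ≡ p ℤ.* μ
  unscale u μ eq = begin
    u             ≡⟨ ℤP.*-identityʳ u ⟨
    u ℤ.* + 1     ≡⟨ cong (λ n → u ℤ.* + n) q≡1 ⟨
    u ℤ.* q       ≡⟨ toℚ-ratio {u} {μ} {co = co} eq ⟩
    p ℤ.* μ       ∎
    where open ≡-Reasoning

square-∣-∣ : ∀ i → i ℤ.* i ≡ + (ℤ.∣ i ∣ ℕ.* ℤ.∣ i ∣)
square-∣-∣ (+ n)      = sym (ℤP.pos-* n n)
square-∣-∣ (-[1+ n ]) = refl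

square∣4 : ∀ n → n ℕ.* n ℕD.∣ 4 → n ℕ.* n ≡ 1 ⊎ n ℕ.* n ≡ 4
square∣4 0 d with () ← ℕD.0∣⇒≡0 d
square∣4 1 _ = inj₁ refl
square∣4 2 _ = inj₂ refl
square∣4 n@(suc (suc (suc _))) d =
  contradiction (ℕP.≤-trans (ℕP.*-mono-≤ {3} {n} {3} {n} (s≤s (s≤s (s≤s z≤n))) (s≤s (s≤s (s≤s z≤n)))) (ℕD.∣⇒≤ d)) λ
    { (s≤s (s≤s (s≤s (s≤s ())))) }

-- A discriminant is 0 or 1 modulo 4, while -1 is 3.
disc≢-1 : ∀ φ → disc φ ≢ - (+ 1)
disc≢-1 (bqf α β γ) Δ≡-1 with parity β
... | inj₁ (q , refl) = contradiction (begin
    + 1                           ≡⟨⟩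
    - (- (+ 1))                   ≡⟨ cong -_ Δ≡-1 ⟨
    - disc (bqf α (q ℤ.+ q) γ)
      ≡⟨ solve 3 (λ α q γ → :- ((q :+ q) :* (q :+ q) :- con (+ 4) :* α :* γ) :=
           con (+ 2) :* (con (+ 2) :* (α :* γ :- q :* q))) refl α q γ ⟩
    + 2 ℤ.* (+ 2 ℤ.* (α ℤ.* γ ℤ.- q ℤ.* q)) ∎) (2∤1 _)
  where
  open ≡-Reasoning
  open ℤS.+-*-Solver
... | inj₂ (q , refl) = contradiction (ℤP.*-cancelˡ-≡ (+ 2) _ _ (begin
    + 2                           ≡⟨⟩
    + 1 ℤ.- (- (+ 1))             ≡⟨ cong (ℤ._-_ (+ 1)) Δ≡-1 ⟨
    + 1 ℤ.- disc (bqf α (+ 1 ℤ.+ (q ℤ.+ q)) γ)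
      ≡⟨ solve 3 (λ α q γ → con (+ 1) :- ((con (+ 1) :+ (q :+ q)) :* (con (+ 1) :+ (q :+ q)) :- con (+ 4) :* α :* γ) :=
           con (+ 2) :* (con (+ 2) :* (α :* γ :- q :- q :* q))) refl α q γ ⟩
    + 2 ℤ.* (+ 2 ℤ.* (α ℤ.* γ ℤ.- q ℤ.- q ℤ.* q)) ∎)) (2∤1 _)
  where
  open ≡-Reasoning
  open ℤS.+-*-Solver

-- As R = ±1, p² divides 4. If p² = 1, the discriminant is 4R = ±4; if p² = 4, it is R, and -1 is
-- excluded.
disc-of-primitive-part : ∀ {p R} φ → R ∣ + 1 → + 4 ℤ.* R ≡ p ℤ.* p ℤ.* disc φ →
  disc φ ≡ + 1 ⊎ disc φ ≡ + 4 ⊎ disc φ ≡ - (+ 4)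
disc-of-primitive-part {p} {R} φ R∣1 4R≡
  with square∣4 ℤ.∣ p ∣ (subst (ℕD._∣ 4) (cong ℤ.∣_∣ (square-∣-∣ p)) (∣⇒∣ᵤ (∣-trans
         (divides (disc φ) (trans 4R≡ (ℤP.*-comm (p ℤ.* p) (disc φ)))) (*-monoʳ-∣ (+ 4) R∣1))))
... | inj₁ pp≡1 = inj₂ ([ (λ R≡1 → inj₁ (trans Δ≡ (cong (ℤ._*_ (+ 4)) R≡1)))
                        , (λ R≡-1 → inj₂ (trans Δ≡ (cong (ℤ._*_ (+ 4)) R≡-1))) ]′ (∣1⇒±1 R∣1))
  where
  Δ≡ : disc φ ≡ + 4 ℤ.* R
  Δ≡ = sym (trans 4R≡ (trans (cong (ℤ._* disc φ) (trans (square-∣-∣ p) (cong +_ pp≡1))) (ℤP.*-identityˡ (disc φ))))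
... | inj₂ pp≡4 = [ (λ R≡1 → inj₁ (trans Δ≡ R≡1)) , (λ R≡-1 → contradiction (trans Δ≡ R≡-1) (disc≢-1 φ)) ]′ (∣1⇒±1 R∣1)
  where
  Δ≡ : disc φ ≡ R
  Δ≡ = sym (ℤP.*-cancelˡ-≡ (+ 4) R (disc φ) (trans 4R≡ (cong (ℤ._* disc φ) (trans (square-∣-∣ p) (cong +_ pp≡4)))))

theorem3p2 : (α β γ : ℤ) → gcd (gcd α β) γ ≡ + 1 → disc (bqf α β γ) ≢ + 0 →
    (F : Quartic) → InVJ (bqf α β γ) F → Irreducible F → QFMaximal F →
    (h f g : BQF) → coeffs4 F ≡ compose h f g →
    Proportional (jacobian f g) (bqf α β γ) →
    FundamentalDisc (disc h) × Primitive f g ×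
    (disc (jacobian f g) ≡ + 4 ⊎ disc (jacobian f g) ≡ - (+ 4)) ×
    (disc (bqf α β γ) ≡ + 1 ⊎ disc (bqf α β γ) ≡ + 4 ⊎ disc (bqf α β γ) ≡ - (+ 4))
theorem3p2 α β γ gcd≡1 Δ≢0 F _ irreducible maximal h@(bqf h2 h1 h0) f@(bqf f2 f1 f0) g@(bqf g2 g1 g0) F≡ proportional
  with p , p≢0 , J≡ ← proportional⇒multiple (jacobian f g) α β γ gcd≡1 proportional =
    fundamental h (index∣1 F irreducible maximal h2 h1 h0 f2 f1 f0 g2 g1 g0 F≡ R≢0)
  -- The gcd divides the unit R, so its absolute value is 1; by definition it is of the form `+ n`,
  -- so it is 1 itself.
  , (discJ≢0 , cong +_ (∣1⇒∣i∣≡1 (∣-trans content∣R R∣1′)))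
  , [ (λ R≡1 → inj₁ (trans discJ≡4R (cong (ℤ._*_ (+ 4)) R≡1)))
    , (λ R≡-1 → inj₂ (trans discJ≡4R (cong (ℤ._*_ (+ 4)) R≡-1))) ]′ (∣1⇒±1 R∣1′)
  , disc-of-primitive-part {p} (bqf α β γ) R∣1′ (trans (sym discJ≡4R) discJ≡ppΔ)
  where
  open Fℤ.Composite h2 h1 h0 f2 f1 f0 g2 g1 g0 using (a; b; c; R)
  open ≡-Reasoning
  open ℤS.+-*-Solver

  discJ≡4R : disc (jacobian f g) ≡ + 4 ℤ.* R
  discJ≡4R = solve 3 (λ a b c → (con (+ 2) :* b) :* (con (+ 2) :* b) :- con (+ 4) :* a :* c :=
    con (+ 4) :* (b :* b :- a :* c)) refl a b c

  discJ≡ppΔ : disc (jacobian f g) ≡ p ℤ.* p ℤ.* disc (bqf α β γ)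
  discJ≡ppΔ = begin
    disc (jacobian f g)                                 ≡⟨ cong disc J≡ ⟩
    disc (bqf (p ℤ.* α) (p ℤ.* β) (p ℤ.* γ))
      ≡⟨ solve 4 (λ p α β γ → p :* β :* (p :* β) :- con (+ 4) :* (p :* α) :* (p :* γ) :=
           p :* p :* (β :* β :- con (+ 4) :* α :* γ)) refl p α β γ ⟩
    p ℤ.* p ℤ.* disc (bqf α β γ)                        ∎

  discJ≢0 : disc (jacobian f g) ≢ + 0
  discJ≢0 eq with ℤP.i*j≡0⇒i≡0∨j≡0 (p ℤ.* p) (trans (sym discJ≡ppΔ) eq)
  ... | inj₂ Δ≡0 = Δ≢0 Δ≡0
  ... | inj₁ pp≡0 = [ p≢0 , p≢0 ]′ (ℤP.i*j≡0⇒i≡0∨j≡0 p pp≡0)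

  R≢0 : R ≢ + 0
  R≢0 R≡0 = discJ≢0 (trans discJ≡4R (cong (ℤ._*_ (+ 4)) R≡0))

  R∣1′ : R ∣ + 1
  R∣1′ = R∣1 F irreducible maximal h2 h1 h0 f2 f1 f0 g2 g1 g0 F≡ R≢0

  -- The content divides both b² and ac.
  content∣R : gcd (gcd a b) c ∣ R
  content∣R = ∣m∣n⇒∣m-n
    (∣m⇒∣m*n {content} {b} b (∣ᵤ⇒∣ (ℕD.∣-trans (gcd[i,j]∣i (gcd a b) c) (gcd[i,j]∣j a b))))
    (∣n⇒∣m*n {content} a {c} (∣ᵤ⇒∣ (gcd[i,j]∣j (gcd a b) c)))
    where content = gcd (gcd a b) c
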